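{- For any graph $H$ without isolated vertices on $k\geq 1$ edges, with chromatic index $\chi'$ and vertex cover number $\tau$, $$\frac{k^2}{4\chi'} \leq \frac{w_{\max}(H)}{2} \leq AR_{FF}(H) \leq 2\,w_{\mathrm{greedy}}(H) \leq (\tau+1)k.$$
   Context: All graphs are finite and simple; colors are natural numbers $1,2,\ldots$. An edge-coloring is proper if adjacent edges receive distinct colors; an edge-colored graph is rainbow if all its edges have distinct colors, and a rainbow coloring of $H$ is an edge-coloring of $H$ by natural numbers in which all edges have distinct colors. A copy of $H$ is a (not necessarily induced) subgraph isomorphic to $H$. The chromatic index is the smallest number of colors in a proper edge-coloring; the vertex cover number is the smallest size of a set of vertices meeting every edge. $AR_{FF}(H)$ (First-Fit anti-Ramsey number): Builder presents vertices and edges of a simple graph, one edge at a time, and each new edge is immediately colored by Painter with the smallest color in $\{1,2,\ldots\}$ not used on an adjacent edge already presented (First-Fit). $AR_{FF}(H)$ is the smallest $t$ such that Builder can present $t$ edges so that the resulting colored graph contains a rainbow copy of $H$. The weight of a matching $M$ with respect to an edge-coloring $c$ is $\sum_{e\in M} c(e)$. A maximum matching for $c$ is a matching of largest weight with respect to $c$. A greedy matching for $c$ is a matching constructed by repeatedly taking an edge of highest color that is not adjacent to (and distinct from) any edge already picked, until no such edge remains; for a rainbow coloring $c$ it is unique. Define $$w_{\max}(H) = \min_{c}\ \sum_{e\in M} c(e),\quad M \text{ a maximum matching for } c,$$ $$w_{\mathrm{greedy}}(H) = \min_{c}\ \sum_{e\in M} c(e),\quad M \text{ the greedy matching for } c,$$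 where both minima are over all rainbow colorings $c$ of $H$. -}

module Defs where

open import Algebra.Properties.CommutativeMonoid.Sum using (sum)
open import Data.Bool.Base using (if_then_else_)
open import Data.Fin.Base as Fin using (Fin; fromℕ<)
open import Data.Fin.Subset using (Subset; ⊥; ⁅_⁆; _∪_; _∈_; _∉_; ∣_∣)
open import Data.Nat.Base using (ℕ; zero; suc; _*_; _≤_; NonZero)
open import Data.Nat.Properties using (+-0-commutativeMonoid)
open import Data.Product.Base using (Σ-syntax; ∃-syntax; _×_; _,_; proj₁; proj₂)
open import Data.Sum.Base using (_⊎_)
open import Data.Vec.Base using (lookup)
open import Function.Base using (_∘_)
open import Function.Definitions using (Injective)
open import Relation.Binary.PropositionalEquality.Core using (_≡_; _≢_)
open import Relation.Nullary.Negation.Core using (¬_)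

Least : (ℕ → Set) → ℕ → Set
Least P m = P m × (∀ j → P j → m ≤ j)

-- Finite simple graphs with vertex set `Fin n` and edge set `Fin k`.  Writing
-- the ends of an edge in increasing order excludes loops; injectivity of
-- `ends` then excludes parallel edges.
record Graph (n k : ℕ) : Set where
  field
    ends           : Fin k → Fin n × Fin n
    ends-<         : ∀ e → proj₁ (ends e) Fin.< proj₂ (ends e)
    ends-injective : Injective _≡_ _≡_ ends

module _ {n k : ℕ} (G : Graph n k) where
  open Graph G

  Incident : Fin n → Fin k → Set
  Incident v e = v ≡ proj₁ (ends e) ⊎ v ≡ proj₂ (ends e)

  Adjacent : Fin k → Fin k → Set
  Adjacent e f = e ≢ f × ∃[ v ] (Incident v e × Incident v f)

  NoIsolatedVertices : Set
  NoIsolatedVertices = ∀ v → ∃[ e ] Incident v e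

  ----------------------------------------------------------------------
  -- Chromatic index and vertex cover number

  Proper : {C : Set} → (Fin k → C) → Set
  Proper c = ∀ e f → Adjacent e f → c e ≢ c f

  IsChromaticIndex : ℕ → Set
  IsChromaticIndex = Least λ q → Σ[ c ∈ (Fin k → Fin q) ] Proper c

  IsVertexCover : Subset n → Set
  IsVertexCover S = ∀ e → ∃[ v ] (v ∈ S × Incident v e)

  IsVertexCoverNumber : ℕ → Set
  IsVertexCoverNumber = Least λ s → ∃[ S ] (IsVertexCover S × ∣ S ∣ ≡ s)

  ----------------------------------------------------------------------
  -- Matchings

  IsMatching : Subset k → Set
  IsMatching M = ∀ e f → e ∈ M → f ∈ M → ¬ Adjacent e f

  weight : (Fin k → ℕ) → Subset k → ℕ
  weight c M = sum +-0-commutativeMonoid λ e → if lookup M e then c e else 0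

  -- Colors are positive.
  RainbowColoring : (Fin k → ℕ) → Set
  RainbowColoring c = (∀ e → 1 ≤ c e) × Injective _≡_ _≡_ c

  IsMaximumMatching : (Fin k → ℕ) → Subset k → Set
  IsMaximumMatching c M =
    IsMatching M × (∀ M′ → IsMatching M′ → weight c M′ ≤ weight c M)

  Available : Subset k → Fin k → Set
  Available M e = e ∉ M × (∀ f → f ∈ M → ¬ Adjacent e f)

  -- `GreedyRun c M`: the edges of M can be the ones picked after finitely many
  -- steps of the greedy procedure, which need not have terminated yet.
  data GreedyRun (c : Fin k → ℕ) : Subset k → Set where
    start : GreedyRun c ⊥
    pick  : ∀ {M} e → GreedyRun c M → Available M e →
            (∀ f → Available M f → c f ≤ c e) → GreedyRun c (M ∪ ⁅ e ⁆)

  IsGreedyMatching : (Fin k → ℕ) → Subset k → Set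
  IsGreedyMatching c M = GreedyRun c M × (∀ e → ¬ Available M e)

  Is-w-max : ℕ → Set
  Is-w-max = Least λ w →
    ∃[ c ] (RainbowColoring c × ∃[ M ] (IsMaximumMatching c M × weight c M ≡ w))

  Is-w-greedy : ℕ → Set
  Is-w-greedy = Least λ w →
    ∃[ c ] (RainbowColoring c × ∃[ M ] (IsGreedyMatching c M × weight c M ≡ w))

  ----------------------------------------------------------------------
  -- First-Fit

  -- The edges are presented in the order 0, 1, 2, … of their indices.
  IsFirstFit : (Fin k → ℕ) → Set
  IsFirstFit c = ∀ e → Least
    (λ x → 1 ≤ x × (∀ f → f Fin.< e → Adjacent f e → c f ≢ x)) (c e)

-- A copy of H in G whose edges have distinct colors under c.  Since `vertex` is
-- injective, `incident` says that `edge e` joins the images of the ends of e.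
record RainbowCopy {n k m t} (H : Graph n k) (G : Graph m t)
                   (c : Fin t → ℕ) : Set where
  field
    vertex           : Fin n → Fin m
    edge             : Fin k → Fin t
    vertex-injective : Injective _≡_ _≡_ vertex
    incident         : ∀ v e → Incident H v e → Incident G (vertex v) (edge e)
    rainbow          : Injective _≡_ _≡_ (c ∘ edge)

-- First-Fit is deterministic, so a strategy of Builder is just a graph with
-- ordered edges.
CanForce : ∀ {n k} → Graph n k → ℕ → Set
CanForce H t = ∃[ m ] Σ[ G ∈ Graph m t ] ∃[ c ] (IsFirstFit G c × RainbowCopy H G c)

IsAR-FF : ∀ {n k} → Graph n k → ℕ → Set
IsAR-FF H = Least (CanForce H)

-- Lets 4 χ′ be used as a denominator.
4χ′≢0 : ∀ {n k χ′} (H : Graph n k) → 1 ≤ k → IsChromaticIndex H χ′ →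
        NonZero (4 * χ′)
4χ′≢0 {χ′ = suc _} H _   _             = _
4χ′≢0 {χ′ = zero}  H 1≤k ((c , _) , _) with () ← c (fromℕ< 1≤k)

{-# OPTIONS --safe #-}
module Submission where

-- Lower bounds: the classes of a proper coloring with χ′ colors are matchings, so a
-- maximum matching has at least a χ′-th of the total weight, which is at least
-- k² / 2 for distinct positive colors.  In a First-Fit coloring an edge of color i
-- sees all the colors below i, so the colors up to those of a matching M of the
-- rainbow copy account for w(M) edges of G, each counted for at most two edges of M.
--
-- Upper bounds: for a greedy matching M, let Builder present, color by color, at both
-- ends of every edge e in M edges of the colors 1, …, c(e), using the edge of H of
-- that color where there is one.  As every edge of H meets an edge of M of at least
-- its color, H appears with the coloring c.  To make a greedy matching light, split
-- the edges into τ stars and color star after star, in one order or in the reverse.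

open import Defs
open import Algebra.Properties.CommutativeMonoid.Sum using (sum; ∑-comm)
open import Data.Bool.Base using (true; false; if_then_else_)
open import Data.Fin.Base as Fin using (Fin; zero; suc; toℕ; fromℕ<; punchIn; punchOut; finToFun; funToFin)
open import Data.Fin.Properties as Fin
  using (_≟_; any?; all?; toℕ-injective; toℕ<n; toℕ-fromℕ<; fromℕ<-injective; injective⇒≤;
         +↔⊎; *↔×; punchOut-injective; finToFun-funToFin)
open import Data.Fin.Subset using (Subset; ⊥; ⁅_⁆; _∪_; _∈_; ∣_∣)
open import Data.Fin.Subset.Properties
  using (_∈?_; anySubset?; ∉⊥; x∈p∪q⁺; x∈p∪q⁻; x∈⁅x⁆; x∈⁅y⁆⇒x≡y; p⊂q⇒∣p∣<∣q∣; ∣p∣≤n; p⊆p∪q)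
open import Data.Integer.Base as ℤ using (+_; +≤+)
open import Data.Integer.Properties using (pos-*)
open import Data.Nat.Base hiding (_/_)
open import Data.Nat.Properties as ℕ hiding (_≟_)
open import Data.Nat.Tactic.RingSolver using (solve-∀)
open import Data.Product.Base using (Σ-syntax; ∃; ∃-syntax; _×_; _,_; proj₁; proj₂; uncurry)
open import Data.Product.Function.NonDependent.Propositional using (_×-↔_)
open import Data.Rational.Base as ℚ using (_/_)
open import Data.Rational.Properties using (toℚᵘ-cancel-≤; toℚᵘ-fromℚᵘ)
open import Data.Rational.Unnormalised.Base using (mkℚᵘ; *≤*)
import Data.Rational.Unnormalised.Properties as ℚᵘ
open import Data.Sum.Base using (_⊎_; inj₁; inj₂) renaming (map₂ to map₂⊎)
open import Data.Sum.Function.Propositional using (_⊎-↔_)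
open import Data.Sum.Properties using (inj₁-injective)
open import Data.Vec.Base using (_∷_; []; lookup; tabulate)
open import Data.Vec.Properties using (lookup∘tabulate; []=⇒lookup; lookup⇒[]=)
open import Function.Base using (_∘_; id; case_of_; _∋_)
open import Function.Bundles using (_↔_; Inverse; Injection; mk↔ₛ′)
open import Function.Definitions using (Injective)
open import Function.Properties.Inverse using (↔-refl; ↔-sym; ↔-trans; ↔⇒↣)
open import Relation.Binary.Definitions using (tri<; tri≈; tri>)
open import Relation.Binary.PropositionalEquality
open import Relation.Nullary using (Dec; yes; no; does; ¬_; ¬?; contradiction; _×-dec_; _⊎-dec_; _→-dec_)
open import Relation.Nullary.Decidable using (dec-true; map′)
open import Relation.Unary using (Decidable)

-- Search over finite sets, and counting by injections.

Σℕ : ∀ {n} → (Fin n → ℕ) → ℕ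
Σℕ = sum +-0-commutativeMonoid

-- The minimum is found by testing every value up to a known witness. The First-Fit number is
-- obtained this way, so `CanForce` has to be shown decidable.
least : ∀ {P : ℕ → Set} → Decidable P → ∀ {b} → P b → ∃ (Least P)
least {P} P? {b} Pb with search (suc b)
  where
  search : ∀ m → ∃ (Least P) ⊎ (∀ j → j < m → ¬ P j)
  search zero    = inj₂ λ _ ()
  search (suc m) with search m
  ... | inj₁ found = inj₁ found
  ... | inj₂ none with P? m
  ...   | yes Pm = inj₁ (m , Pm , λ j Pj → ≮⇒≥ λ j<m → none j j<m Pj)
  ...   | no ¬Pm = inj₂ λ j j<1+m → case m<1+n⇒m<n∨m≡n j<1+m of λ where
                     (inj₁ j<m)  → none j j<m
                     (inj₂ refl) → ¬Pm
... | inj₁ found = found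
... | inj₂ none  = contradiction Pb (none b ≤-refl)

greatest : ∀ {P : ℕ → Set} → Decidable P → ∀ b → (∀ j → P j → j ≤ b) →
           ∀ {i} → P i → ∃[ m ] (P m × (∀ j → P j → j ≤ m))
greatest P? b bound Pi with P? b
... | yes Pb = b , Pb , bound
greatest P? zero bound {i} Pi | no ¬P0 with refl ← n≤0⇒n≡0 (bound i Pi) = contradiction Pi ¬P0
greatest P? (suc b) bound Pi | no ¬Pb = greatest P? b
  (λ j Pj → s≤s⁻¹ (≤∧≢⇒< (bound j Pj) λ { refl → ¬Pb Pj })) Pi

-- A missed value `y` could be punched out of the codomain, leaving an injection into a set with one
-- element fewer.
injective⇒surjective : ∀ {n} {f : Fin n → Fin n} → Injective _≡_ _≡_ f →
                       ∀ y → ∃[ x ] f x ≡ y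
injective⇒surjective {suc n} {f} f-inj y with any? (λ x → f x ≟ y)
... | yes hit  = hit
... | no  miss = contradiction (injective⇒≤ g-inj) 1+n≰n
  where
  y≢f : ∀ x → y ≢ f x
  y≢f x eq = miss (x , sym eq)
  g-inj : Injective _≡_ _≡_ λ x → punchOut (y≢f x)
  g-inj {x} {x′} eq = f-inj (punchOut-injective (y≢f x) (y≢f x′) eq)

-- Functions between finite sets are enumerated by numbers. Decoding recovers a function only
-- pointwise, hence the condition that `P` respects `≗`.
∃fun? : ∀ {a b} {P : (Fin a → Fin b) → Set} → (∀ {f g} → f ≗ g → P f → P g) →
        Decidable P → Dec (∃ P)
∃fun? {P = P} resp P? = map′ (λ (i , p) → finToFun i , p)
  (λ (f , p) → funToFin f , resp (sym ∘ finToFun-funToFin f) p)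
  (any? λ i → P? (finToFun i))

to-injective : ∀ {A B : Set} (I : A ↔ B) → Injective _≡_ _≡_ (Inverse.to I)
to-injective I = Injection.injective (↔⇒↣ I)

card-≤ : ∀ {a b} {A B : Set} → Fin a ↔ A → Fin b ↔ B →
         (f : A → B) → Injective _≡_ _≡_ f → a ≤ b
card-≤ A↔ B↔ f f-inj = injective⇒≤ {f = Inverse.from B↔ ∘ f ∘ Inverse.to A↔}
  (to-injective A↔ ∘ f-inj ∘ to-injective (↔-sym B↔))

-- A disjoint union of size `Σℕ f`, by which inequalities between sums become injections.
Units : ∀ {n} → (Fin n → ℕ) → Set
Units {n} f = Σ[ e ∈ Fin n ] Fin (f e)

units : ∀ {n} (f : Fin n → ℕ) → Fin (Σℕ f) ↔ Units f
units {zero}  f = mk↔ₛ′ (λ ()) (λ ()) (λ ()) (λ ())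
units {suc n} f = ↔-trans +↔⊎ (↔-trans (↔-refl ⊎-↔ units (f ∘ suc)) cons)
  where
  cons : (Fin (f zero) ⊎ Units (f ∘ suc)) ↔ Units f
  cons = mk↔ₛ′ (λ { (inj₁ i) → zero , i ; (inj₂ (e , i)) → suc e , i })
               (λ { (zero , i) → inj₁ i ; (suc e , i) → inj₂ (e , i) })
               (λ { (zero , i) → refl ; (suc e , i) → refl })
               (λ { (inj₁ i) → refl ; (inj₂ (e , i)) → refl })

Units-≡ : ∀ {n} {f : Fin n → ℕ} {x y : Units f} → proj₁ x ≡ proj₁ y →
          toℕ (proj₂ x) ≡ toℕ (proj₂ y) → x ≡ y
Units-≡ {x = e , i} {y = .e , j} refl eq = cong (e ,_) (toℕ-injective eq)

-- The summand in `weight`, so that `weight H c M` is `Σℕ (restrict M c)` by definition.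
restrict : ∀ {n} → Subset n → (Fin n → ℕ) → Fin n → ℕ
restrict M c e = if lookup M e then c e else 0

restrict-∈ : ∀ {n} (M : Subset n) c e → Fin (restrict M c e) → e ∈ M
restrict-∈ M c e i with lookup M e in eq
... | true = lookup⇒[]= e M eq

restrict-< : ∀ {n} (M : Subset n) c e (i : Fin (restrict M c e)) → toℕ i < c e
restrict-< M c e i with lookup M e
... | true = toℕ<n i

restrict-fill : ∀ {n} (M : Subset n) c {e} → e ∈ M → ∀ {i} → i < c e →
                ∃[ j ] toℕ {restrict M c e} j ≡ i
restrict-fill M c {e} e∈M i<ce rewrite []=⇒lookup e∈M = fromℕ< i<ce , toℕ-fromℕ< i<ce

member-≡ : ∀ {n} (S : Subset n) {x y : Units (restrict S (λ _ → 1))} →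
           proj₁ x ≡ proj₁ y → x ≡ y
member-≡ S {e , i} {f , j} eq = Units-≡ eq
  (trans (n<1⇒n≡0 (restrict-< S _ e i)) (sym (n<1⇒n≡0 (restrict-< S _ f j))))

members : ∀ {n} (S : Subset n) → Fin ∣ S ∣ ↔ Units (restrict S (λ _ → 1))
members S = subst (λ s → Fin s ↔ Units (restrict S (λ _ → 1))) (sym (size S)) (units _)
  where
  size : ∀ {n} (S : Subset n) → ∣ S ∣ ≡ Σℕ (restrict S (λ _ → 1))
  size []          = refl
  size (true ∷ S)  = cong suc (size S)
  size (false ∷ S) = size S

select : ∀ {n} {P : Fin n → Set} → Decidable P → Subset n
select P? = tabulate (does ∘ P?)

select⁺ : ∀ {n} {P : Fin n → Set} (P? : Decidable P) {e} → P e → e ∈ select P?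
select⁺ P? {e} p = lookup⇒[]= e _ (trans (lookup∘tabulate _ e) (dec-true (P? e) p))

select⁻ : ∀ {n} {P : Fin n → Set} (P? : Decidable P) {e} → e ∈ select P? → P e
select⁻ P? {e} e∈ with P? e | trans (sym (lookup∘tabulate (does ∘ P?) e)) ([]=⇒lookup e∈)
... | yes p | _ = p

Σℕ-mono-≤ : ∀ {n} {f g : Fin n → ℕ} → (∀ e → f e ≤ g e) → Σℕ f ≤ Σℕ g
Σℕ-mono-≤ {zero}  f≤g = z≤n
Σℕ-mono-≤ {suc n} f≤g = +-mono-≤ (f≤g zero) (Σℕ-mono-≤ (f≤g ∘ suc))

term≤Σℕ : ∀ {n} (f : Fin n → ℕ) e → f e ≤ Σℕ f
term≤Σℕ f zero    = m≤m+n _ _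
term≤Σℕ f (suc e) = ≤-trans (term≤Σℕ (f ∘ suc) e) (m≤n+m _ _)

Σℕ-≤-* : ∀ {n} {f : Fin n → ℕ} {b} → (∀ e → f e ≤ b) → Σℕ f ≤ n * b
Σℕ-≤-* {zero}  f≤b = z≤n
Σℕ-≤-* {suc n} f≤b = +-mono-≤ (f≤b zero) (Σℕ-≤-* (f≤b ∘ suc))

-- Rainbow colorings and permutations from a priority function.

module Rank {k} (β : Fin k → ℕ) where

  -- Orders the edges by `β` and breaks ties by index: indices are below `k`, so a larger `β` always
  -- wins.
  key : Fin k → ℕ
  key e = toℕ e + β e * k

  key-mono : ∀ {e f} → β e < β f → key e < key f
  key-mono {e} {f} βe<βf = begin-strict
    toℕ e + β e * k  <⟨ +-monoˡ-< _ (toℕ<n e) ⟩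
    suc (β e) * k    ≤⟨ *-monoˡ-≤ k βe<βf ⟩
    β f * k          ≤⟨ m≤n+m _ _ ⟩
    key f            ∎
    where open ≤-Reasoning

  key-injective : Injective _≡_ _≡_ key
  key-injective {e} {f} eq with <-cmp (β e) (β f)
  ... | tri< lt _ _ = contradiction eq (<⇒≢ (key-mono lt))
  ... | tri> _ _ gt = contradiction (sym eq) (<⇒≢ (key-mono gt))
  ... | tri≈ _ βe≡βf _ = toℕ-injective
    (+-cancelʳ-≡ (β f * k) _ _ (trans (cong (λ b → toℕ e + b * k) (sym βe≡βf)) eq))

  below : Fin k → Subset k
  below e = select λ f → key f ≤? key e

  rank : Fin k → ℕ
  rank e = ∣ below e ∣

  below⇒β≤ : ∀ {e f} → f ∈ below e → β f ≤ β e
  below⇒β≤ {e} f∈ = ≮⇒≥ λ βe<βf → <⇒≱ (key-mono βe<βf) (select⁻ (λ f → key f ≤? key e) f∈)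

  rank-mono-key : ∀ {e f} → key e < key f → rank e < rank f
  rank-mono-key {e} {f} lt = p⊂q⇒∣p∣<∣q∣
    ( (λ g∈ → select⁺ (λ g → key g ≤? key f)
                (≤-trans (select⁻ (λ g → key g ≤? key e) g∈) (<⇒≤ lt)))
    , f , select⁺ (λ g → key g ≤? key f) ≤-refl
    , λ f∈ → <⇒≱ lt (select⁻ (λ g → key g ≤? key e) f∈))

  rank-mono : ∀ {e f} → β e < β f → rank e < rank f
  rank-mono = rank-mono-key ∘ key-mono

  rank-injective : Injective _≡_ _≡_ rank
  rank-injective {e} {f} eq with <-cmp (key e) (key f)
  ... | tri< lt _ _ = contradiction eq (<⇒≢ (rank-mono-key lt))
  ... | tri≈ _ ke≡kf _ = key-injective ke≡kf
  ... | tri> _ _ gt = contradiction (sym eq) (<⇒≢ (rank-mono-key gt))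

  1≤rank : ∀ e → 1 ≤ rank e
  1≤rank e = ≤-trans (s≤s z≤n) (toℕ<n (Inverse.from (members (below e))
    (e , proj₁ (restrict-fill (below e) _ (select⁺ (λ g → key g ≤? key e) ≤-refl) (s≤s z≤n)))))

  rank≤k : ∀ e → rank e ≤ k
  rank≤k e = ∣p∣≤n (below e)

-- The ranks are distinct and lie in 1, ..., k; lowered by one they form an injection of `Fin k`
-- into itself, hence a permutation.
sort : ∀ {k} (β : Fin k → ℕ) → Σ[ π ∈ Fin k ↔ Fin k ]
       (∀ {e f} → β e < β f → Inverse.to π e Fin.< Inverse.to π f)
sort {k} β = mk↔ₛ′ to from to∘from (λ e → to-inj (to∘from (to e))) , to-mono
  where
  open Rank β

  pred<k : ∀ e → pred (rank e) < k
  pred<k e = ≤-trans (≤-reflexive (suc-pred (rank e) {{>-nonZero (1≤rank e)}})) (rank≤k e)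

  to : Fin k → Fin k
  to e = fromℕ< (pred<k e)

  suc-to : ∀ e → suc (toℕ (to e)) ≡ rank e
  suc-to e = trans (cong suc (toℕ-fromℕ< (pred<k e))) (suc-pred (rank e) {{>-nonZero (1≤rank e)}})

  to-inj : Injective _≡_ _≡_ to
  to-inj {e} {f} eq = rank-injective
    (trans (sym (suc-to e)) (trans (cong (suc ∘ toℕ) eq) (suc-to f)))

  from : Fin k → Fin k
  from = proj₁ ∘ injective⇒surjective to-inj

  to∘from : ∀ i → to (from i) ≡ i
  to∘from = proj₂ ∘ injective⇒surjective to-inj

  to-mono : ∀ {e f} → β e < β f → to e Fin.< to f
  to-mono {e} {f} lt = s≤s⁻¹ (subst₂ _<_ (sym (suc-to e)) (sym (suc-to f)) (rank-mono lt))

-- Matchings and the greedy procedure.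

module _ {n k : ℕ} (G : Graph n k) where
  open Graph G

  lo hi : Fin k → Fin n
  lo = proj₁ ∘ ends
  hi = proj₂ ∘ ends

  Incident? : ∀ v e → Dec (Incident G v e)
  Incident? v e = (v ≟ lo e) ⊎-dec (v ≟ hi e)

  Adjacent? : ∀ e f → Dec (Adjacent G e f)
  Adjacent? e f = ¬? (e ≟ f) ×-dec any? λ v → Incident? v e ×-dec Incident? v f

  Adjacent-sym : ∀ {e f} → Adjacent G e f → Adjacent G f e
  Adjacent-sym (e≢f , v , v∈e , v∈f) = e≢f ∘ sym , v , v∈f , v∈e

  lo≢hi : ∀ e → lo e ≢ hi e
  lo≢hi e eq = <⇒≢ (ends-< e) (cong toℕ eq)

  IsMatching? : Decidable (IsMatching G)
  IsMatching? M = all? λ e → all? λ f → (e ∈? M) →-dec (f ∈? M) →-dec ¬? (Adjacent? e f)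

  Available? : ∀ M → Decidable (Available G M)
  Available? M e = ¬? (e ∈? M) ×-dec all? λ f → (f ∈? M) →-dec ¬? (Adjacent? e f)

  matching-unique : ∀ {M} → IsMatching G M → ∀ {v e f} → e ∈ M → f ∈ M →
                    Incident G v e → Incident G v f → e ≡ f
  matching-unique isM {v} {e} {f} e∈M f∈M v∈e v∈f with e ≟ f
  ... | yes e≡f = e≡f
  ... | no  e≢f = contradiction (e≢f , v , v∈e , v∈f) (isM e f e∈M f∈M)

  greedyRun⇒matching : ∀ {c M} → GreedyRun G c M → IsMatching G M
  greedyRun⇒matching start e f e∈⊥ = contradiction e∈⊥ ∉⊥
  greedyRun⇒matching (pick {M} e run (_ , e-free) _) f g f∈ g∈ adj
    with x∈p∪q⁻ M ⁅ e ⁆ f∈ | x∈p∪q⁻ M ⁅ e ⁆ g∈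
  ... | inj₁ f∈M | inj₁ g∈M = greedyRun⇒matching run f g f∈M g∈M adj
  ... | inj₁ f∈M | inj₂ g∈e rewrite x∈⁅y⁆⇒x≡y e g∈e = e-free f f∈M (Adjacent-sym adj)
  ... | inj₂ f∈e | inj₁ g∈M rewrite x∈⁅y⁆⇒x≡y e f∈e = e-free g g∈M adj
  ... | inj₂ f∈e | inj₂ g∈e =
    proj₁ adj (trans (x∈⁅y⁆⇒x≡y e f∈e) (sym (x∈⁅y⁆⇒x≡y e g∈e)))

  Dominated : (Fin k → ℕ) → Subset k → Fin k → Set
  Dominated c M f = ∃[ e ] (e ∈ M × c f ≤ c e × ∃[ v ] (Incident G v e × Incident G v f))

  -- An edge stops being available only when it or an adjacent edge is picked. It was still
  -- available at that moment, so the picked edge has at least its color.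
  greedyRun⇒dominated : ∀ {c M} → GreedyRun G c M → ∀ f → Available G M f ⊎ Dominated c M f
  greedyRun⇒dominated start f = inj₁ (∉⊥ , λ _ g∈⊥ → contradiction g∈⊥ ∉⊥)
  greedyRun⇒dominated (pick {M} e run e-av e-max) f with greedyRun⇒dominated run f
  ... | inj₂ (g , g∈M , rest) = inj₂ (g , p⊆p∪q ⁅ e ⁆ g∈M , rest)
  ... | inj₁ f-av@(f∉M , f-free) with e ≟ f
  ...   | yes refl = inj₂ (e , x∈p∪q⁺ (inj₂ (x∈⁅x⁆ e)) , ≤-refl , lo e , inj₁ refl , inj₁ refl)
  ...   | no  e≢f with Adjacent? f e
  ...     | yes (_ , v , v∈f , v∈e) =
    inj₂ (e , x∈p∪q⁺ (inj₂ (x∈⁅x⁆ e)) , e-max f f-av , v , v∈e , v∈f)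
  ...     | no ¬adj = inj₁
    ( (λ f∈ → case x∈p∪q⁻ M ⁅ e ⁆ f∈ of λ where
         (inj₁ f∈M) → f∉M f∈M
         (inj₂ f∈e) → e≢f (sym (x∈⁅y⁆⇒x≡y e f∈e)))
    , λ g g∈ → case x∈p∪q⁻ M ⁅ e ⁆ g∈ of λ where
         (inj₁ g∈M) → f-free g g∈M
         (inj₂ g∈e) → subst (λ g → ¬ Adjacent G f g) (sym (x∈⁅y⁆⇒x≡y e g∈e)) ¬adj)

  greedy-dominated : ∀ {c M} → IsGreedyMatching G c M → ∀ f → Dominated c M f
  greedy-dominated (run , done) f with greedyRun⇒dominated run f
  ... | inj₁ f-av = contradiction f-av (done f)
  ... | inj₂ dom  = dom

  greedyMatching-exists : ∀ c → ∃ (IsGreedyMatching G c)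
  greedyMatching-exists c = extend k start (m≤m+n k _)
    where
    -- Each pick enlarges `M`, which never has more than `k` edges, so `k` units of fuel suffice.
    extend : ∀ fuel {M} → GreedyRun G c M → k ≤ fuel + ∣ M ∣ → ∃ (IsGreedyMatching G c)
    extend fuel {M} run enough with any? (Available? M)
    ... | no  none = M , run , λ e e-av → none (e , e-av)
    ... | yes (e₀ , e₀-av)
      with greatest (λ j → any? λ e → Available? M e ×-dec (c e ℕ.≟ j)) (Σℕ c)
             (λ { _ (e , _ , refl) → term≤Σℕ c e }) (e₀ , e₀-av , refl)
    ...   | _ , (e , e-av@(e∉M , _) , refl) , e-max = go fuel enough
      where
      run′ : GreedyRun G c (M ∪ ⁅ e ⁆)
      run′ = pick e run e-av (λ f f-av → e-max (c f) (f , f-av , refl))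

      grow : ∣ M ∣ < ∣ M ∪ ⁅ e ⁆ ∣
      grow = p⊂q⇒∣p∣<∣q∣ (p⊆p∪q ⁅ e ⁆ , e , x∈p∪q⁺ (inj₂ (x∈⁅x⁆ e)) , e∉M)

      go : ∀ fuel → k ≤ fuel + ∣ M ∣ → ∃ (IsGreedyMatching G c)
      go zero       enough = contradiction (∣p∣≤n (M ∪ ⁅ e ⁆)) (<⇒≱ (≤-<-trans enough grow))
      go (suc fuel) enough = extend fuel run′
        (≤-trans enough (≤-trans (≤-reflexive (sym (+-suc fuel ∣ M ∣))) (+-monoʳ-≤ fuel grow)))

  maximumMatching-exists : ∀ c → ∃ (IsMaximumMatching G c)
  maximumMatching-exists c
    with greatest (λ j → anySubset? λ M → IsMatching? M ×-dec (weight G c M ℕ.≟ j)) (Σℕ c)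
           (λ { _ (M , _ , refl) → Σℕ-mono-≤ (restrict≤ M) })
           (⊥ , (λ e f e∈⊥ → contradiction e∈⊥ ∉⊥) , refl)
    where
    restrict≤ : ∀ M e → restrict M c e ≤ c e
    restrict≤ M e with lookup M e
    ... | true  = ≤-refl
    ... | false = z≤n
  ... | _ , (M , isM , refl) , M-max = M , isM , λ M′ isM′ → M-max _ (M′ , isM′ , refl)

-- First-Fit colorings and the weight of matchings in a rainbow copy.

module _ {m t} (G : Graph m t) {c : Fin t → ℕ} (ff : IsFirstFit G c) where

  firstFit-sees : ∀ e {i} → 1 ≤ i → i < c e → ∃[ f ] (f Fin.< e × Adjacent G f e × c f ≡ i)
  firstFit-sees e {i} 1≤i i<ce
    with any? (λ f → (f Fin.<? e) ×-dec Adjacent? G f e ×-dec (c f ℕ.≟ i))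
  ... | yes found = found
  ... | no  none  = contradiction
    (proj₂ (ff e) i (1≤i , λ f f<e adj cf≡i → none (f , f<e , adj , cf≡i))) (<⇒≱ i<ce)

  -- The colors below `c e` occur on distinct edges, so there are at most `t` of them. This leaves
  -- finitely many colorings to search.
  firstFit-bounded : ∀ e → c e < 2 + t
  firstFit-bounded e = s≤s (≤-trans
    (≤-reflexive (sym (suc-pred (c e) {{>-nonZero (proj₁ (proj₁ (ff e)))}})))
    (s≤s (injective⇒≤ {f = proj₁ ∘ seen} seen-inj)))
    where
    seen : (i : Fin (pred (c e))) → ∃[ f ] (f Fin.< e × Adjacent G f e × c f ≡ suc (toℕ i))
    seen i = firstFit-sees e (s≤s z≤n) (pred-cancel-< (toℕ<n i))

    seen-inj : Injective _≡_ _≡_ (proj₁ ∘ seen)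
    seen-inj {i} {j} eq = toℕ-injective (suc-injective
      (trans (sym (proj₂ (proj₂ (proj₂ (seen i))))) (trans (cong c eq) (proj₂ (proj₂ (proj₂ (seen j)))))))

-- A color i ≤ c e of an edge e of the matching is charged to an edge
-- of G of color i meeting e, together with the end at which it meets e.
module _ {n k m t} {H : Graph n k} {G : Graph m t} {c : Fin t → ℕ}
         (ff : IsFirstFit G c) (copy : RainbowCopy H G c) where
  open RainbowCopy copy

  -- The two ends of `e` have distinct images, both among the two ends of `edge e`, so every end is
  -- hit.
  copy-end : ∀ {v e} → Incident G v (edge e) → ∃[ x ] (Incident H x e × vertex x ≡ v)
  copy-end {v} {e} v∈ with incident (lo H e) e (inj₁ refl) | incident (hi H e) e (inj₂ refl) | v∈
  ... | inj₁ l | inj₁ h | _ = contradiction (vertex-injective (trans l (sym h))) (lo≢hi H e)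
  ... | inj₂ l | inj₂ h | _ = contradiction (vertex-injective (trans l (sym h))) (lo≢hi H e)
  ... | inj₁ l | inj₂ h | inj₁ v≡ = lo H e , inj₁ refl , trans l (sym v≡)
  ... | inj₁ l | inj₂ h | inj₂ v≡ = hi H e , inj₂ refl , trans h (sym v≡)
  ... | inj₂ l | inj₁ h | inj₁ v≡ = hi H e , inj₂ refl , trans h (sym v≡)
  ... | inj₂ l | inj₁ h | inj₂ v≡ = lo H e , inj₁ refl , trans l (sym v≡)

  meets : ∀ e {i} → 1 ≤ i → i ≤ c (edge e) →
          ∃[ g ] (c g ≡ i × ∃[ v ] (Incident G v g × Incident G v (edge e)))
  meets e 1≤i i≤c with m≤n⇒m<n∨m≡n i≤c
  ... | inj₁ i<c = let (g , _ , (_ , share) , cg≡i) = firstFit-sees G ff (edge e) 1≤i i<c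
                   in g , cg≡i , share
  -- The color of `edge e` itself is provided by that very edge.
  ... | inj₂ refl = edge e , refl , lo G (edge e) , inj₁ refl , inj₁ refl

  matching-weight-≤ : ∀ {M} → IsMatching H M → weight H (c ∘ edge) M ≤ 2 * t
  matching-weight-≤ {M} isM = card-≤ (units _) *↔× charge charge-injective
    where
    hit : (x : Units (restrict M (c ∘ edge))) → _
    hit (e , i) = meets e (s≤s z≤n) (restrict-< M (c ∘ edge) e i)

    side : ∀ {v g} → Incident G v g → Fin 2
    side (inj₁ _) = zero
    side (inj₂ _) = suc zero

    charge : Units (restrict M (c ∘ edge)) → Fin 2 × Fin t
    charge x = let (g , _ , _ , v∈g , _) = hit x in side v∈g , g

    same-end : ∀ {v v′ g g′} (p : Incident G v g) (q : Incident G v′ g′) →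
               side p ≡ side q → g ≡ g′ → v ≡ v′
    same-end (inj₁ p) (inj₁ q) _ refl = trans p (sym q)
    same-end (inj₂ p) (inj₂ q) _ refl = trans p (sym q)

    charge-injective : Injective _≡_ _≡_ charge
    charge-injective {x@(e , i)} {y@(f , j)} eq
      with hit x | hit y
    ... | g , cg≡ , v , v∈g , v∈e | g′ , cg′≡ , v′ , v′∈g′ , v′∈f
      with cong proj₂ eq
    ... | refl with same-end v∈g v′∈g′ (cong proj₁ eq) refl
    -- The common end is pulled back to a vertex of `H` on both `e` and `f`, which forces `e ≡ f` in
    -- a matching; the color of `g` then determines the position.
    ...   | refl with copy-end v∈e | copy-end v′∈f
    ...     | a , a∈e , va≡v | b , b∈f , vb≡v
      with vertex-injective (trans va≡v (sym vb≡v))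
    ... | refl = Units-≡ (matching-unique H isM (restrict-∈ M (c ∘ edge) e i)
                                              (restrict-∈ M (c ∘ edge) f j) a∈e b∈f)
                         (suc-injective (trans (sym cg≡) cg′≡))

-- Decidability of forcing a rainbow copy with a given number of edges.

firstFit-resp-Adjacent : ∀ {m m′ t} (G : Graph m t) (G′ : Graph m′ t) {c} →
  (∀ {e f} → Adjacent G e f → Adjacent G′ e f) →
  (∀ {e f} → Adjacent G′ e f → Adjacent G e f) →
  IsFirstFit G c → IsFirstFit G′ c
firstFit-resp-Adjacent G G′ to from ff e with ff e
... | (1≤ce , avoid) , minimal =
  (1≤ce , λ f f<e adj → avoid f f<e (from adj)) ,
  λ j (1≤j , free) → minimal j (1≤j , λ f f<e adj → free f f<e (to adj))

firstFit-resp-≗ : ∀ {m t} (G : Graph m t) {c d} → c ≗ d → IsFirstFit G c → IsFirstFit G d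
firstFit-resp-≗ G {c} {d} c≗d ff e with ff e
... | (1≤ce , avoid) , minimal rewrite c≗d e =
  (1≤ce , λ f f<e adj df≡ → avoid f f<e adj (trans (c≗d f) df≡)) ,
  λ j (1≤j , free) → minimal j (1≤j , λ f f<e adj cf≡ → free f f<e adj (trans (sym (c≗d f)) cf≡))

IsFirstFit? : ∀ {m t} (G : Graph m t) → Decidable (IsFirstFit G)
IsFirstFit? G c = all? λ e → map′ (widen e) (narrow e)
  -- Minimality only has to be tested on the finitely many colors below `c e`.
  (free? e (c e) ×-dec allUpTo? (λ j → ¬? (free? e j)) (c e))
  where
  Free : _ → ℕ → Set
  Free e x = 1 ≤ x × (∀ f → f Fin.< e → Adjacent G f e → c f ≢ x)

  free? : ∀ e → Decidable (Free e)
  free? e x = (1 ≤? x) ×-dec all? λ f → (f Fin.<? e) →-dec Adjacent? G f e →-dec ¬? (c f ℕ.≟ x)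

  widen : ∀ e → Free e (c e) × (∀ {j} → j < c e → ¬ Free e j) → Least (Free e) (c e)
  widen e (free , minimal) = free , λ j free-j → ≮⇒≥ λ j<ce → minimal j<ce free-j

  narrow : ∀ e → Least (Free e) (c e) → Free e (c e) × (∀ {j} → j < c e → ¬ Free e j)
  narrow e (free , minimal) = free , λ {j} j<ce free-j → <⇒≱ j<ce (minimal j free-j)

Forces : ∀ {n k m t} → Graph n k → Graph m t → Set
Forces H G = ∃[ c ] (IsFirstFit G c × RainbowCopy H G c)

module _ {n k} (H : Graph n k) where

  copy-resp-≗ : ∀ {m t} {G : Graph m t} {c d} → c ≗ d → RainbowCopy H G c → RainbowCopy H G d
  copy-resp-≗ c≗d copy = record
    { RainbowCopy copy
    ; rainbow = λ {e} {f} eq → rainbow (trans (c≗d (edge e)) (trans eq (sym (c≗d (edge f)))))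
    }
    where open RainbowCopy copy

  RainbowCopy? : ∀ {m t} (G : Graph m t) → Decidable (RainbowCopy H G)
  RainbowCopy? {m} {t} G c = map′
    (λ (vertex , edge , v-inj , inc , rainbow) → record
       { vertex = vertex ; edge = edge ; vertex-injective = v-inj _ _
       ; incident = inc ; rainbow = rainbow _ _ })
    (λ copy → let open RainbowCopy copy in
       vertex , edge , (λ _ _ → vertex-injective) , incident , λ _ _ → rainbow)
    (∃fun? (λ { v≗w (edge , rest) → edge , Data-resp v≗w (λ _ → refl) rest }) λ vertex →
     ∃fun? (λ f≗g rest → Data-resp (λ _ → refl) f≗g rest) λ edge →
       (all? λ v → all? λ w → (vertex v ≟ vertex w) →-dec (v ≟ w)) ×-dec
       (all? λ v → all? λ e → Incident? H v e →-dec Incident? G (vertex v) (edge e)) ×-dec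
       (all? λ e → all? λ f → (c (edge e) ℕ.≟ c (edge f)) →-dec (e ≟ f)))
    where
    Data : (Fin n → Fin m) → (Fin k → Fin t) → Set
    Data vertex edge =
      (∀ v w → vertex v ≡ vertex w → v ≡ w) ×
      (∀ v e → Incident H v e → Incident G (vertex v) (edge e)) ×
      (∀ e f → c (edge e) ≡ c (edge f) → e ≡ f)

    Data-resp : ∀ {v w f g} → v ≗ w → f ≗ g → Data v f → Data w g
    Data-resp v≗w f≗g (v-inj , inc , rainbow) =
      (λ x y eq → v-inj x y (trans (v≗w x) (trans eq (sym (v≗w y))))) ,
      (λ x e x∈e → subst₂ (Incident G) (v≗w x) (f≗g e) (inc x e x∈e)) ,
      λ e f eq → rainbow e f (trans (cong c (f≗g e)) (trans eq (cong c (sym (f≗g f)))))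

  Forces? : ∀ {m t} (G : Graph m t) → Dec (Forces H G)
  Forces? {m} {t} G = map′ (λ (c , ff , copy) → toℕ ∘ c , ff , copy) bounded
    (∃fun? {b = 2 + t} (λ c≗d (ff , copy) → firstFit-resp-≗ G (cong toℕ ∘ c≗d) ff ,
                                copy-resp-≗ (cong toℕ ∘ c≗d) copy)
           λ c → IsFirstFit? G (toℕ ∘ c) ×-dec RainbowCopy? G (toℕ ∘ c))
    where
    bounded : Forces H G → Σ[ c ∈ (Fin t → Fin (2 + t)) ]
              (IsFirstFit G (toℕ ∘ c) × RainbowCopy H G (toℕ ∘ c))
    bounded (c , ff , copy) = (λ e → fromℕ< (c< e)) ,
      firstFit-resp-≗ G (λ e → sym (toℕ-fromℕ< (c< e))) ff ,
      copy-resp-≗ (λ e → sym (toℕ-fromℕ< (c< e))) copy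
      where c< = firstFit-bounded G ff

  -- The map `ψ` reaches every vertex of `G` that lies on an edge. As `H` has no isolated vertices,
  -- this includes every vertex of the copy, which can therefore be pulled back.
  forces-transport : ∀ {m m′ t} (G : Graph m t) (G′ : Graph m′ t) (ψ : Fin m′ → Fin m) →
    Injective _≡_ _≡_ ψ →
    (∀ {v e} → Incident G′ v e → Incident G (ψ v) e) →
    (∀ {v e} → Incident G v e → ∃[ v′ ] (ψ v′ ≡ v × Incident G′ v′ e)) →
    NoIsolatedVertices H → Forces H G → Forces H G′
  forces-transport G G′ ψ ψ-inj to from noIso (c , ff , copy) = c ,
    firstFit-resp-Adjacent G G′
      (λ (e≢f , v , v∈e , v∈f) → let (v₁ , eq₁ , v₁∈e) = from v∈e
                                     (v₂ , eq₂ , v₂∈f) = from v∈f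
        in e≢f , v₁ , v₁∈e , subst (λ v → Incident G′ v _) (ψ-inj (trans eq₂ (sym eq₁))) v₂∈f)
      (λ (e≢f , v , v∈e , v∈f) → e≢f , ψ v , to v∈e , to v∈f) ff ,
    record
      { vertex = proj₁ ∘ image
      ; edge = edge
      ; vertex-injective = λ {v} {w} eq → vertex-injective
          (trans (sym (proj₁ (proj₂ (image v)))) (trans (cong ψ eq) (proj₁ (proj₂ (image w)))))
      ; incident = λ v e v∈e → let (v′ , eq , v′∈) = from (incident v e v∈e) in
          subst (λ v → Incident G′ v (edge e))
            (ψ-inj (trans eq (sym (proj₁ (proj₂ (image v)))))) v′∈
      ; rainbow = rainbow
      }
    where
    open RainbowCopy copy
    image : ∀ v → ∃[ v′ ] (ψ v′ ≡ vertex v × Incident G′ v′ (edge (proj₁ (noIso v))))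
    image v = from (incident v _ (proj₂ (noIso v)))

module _ {n k} (H : Graph n k) (noIso : NoIsolatedVertices H) where

  forces-resp-ends : ∀ {m t} (G G′ : Graph m t) → Graph.ends G ≗ Graph.ends G′ →
                     Forces H G → Forces H G′
  forces-resp-ends G G′ eq = forces-transport H G G′ id id
    (λ {v} {e} → subst (λ p → v ≡ proj₁ p ⊎ v ≡ proj₂ p) (sym (eq e)))
    (λ {v} {e} v∈e → v , refl , subst (λ p → v ≡ proj₁ p ⊎ v ≡ proj₂ p) (eq e) v∈e) noIso

  -- A graph is searched for as a function into codes of pairs of vertices. A given graph agrees
  -- with its decoded form only pointwise, which `forces-resp-ends` bridges.
  forces-on? : ∀ m t → Dec (Σ[ G ∈ Graph m t ] Forces H G)
  forces-on? m t = map′ (λ (_ , G , _ , fr) → G , fr)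
    (λ (G , fr) → uncurry Fin.combine ∘ Graph.ends G , G , (λ e → sym (Fin.remQuot-combine _ _)) , fr)
    (∃fun? (λ f≗g (G , eq , fr) → G , (λ e → trans (eq e) (cong (Fin.remQuot m) (f≗g e))) , fr) decide)
    where
    decide : (f : Fin t → Fin (m * m)) →
             Dec (Σ[ G ∈ Graph m t ] (Graph.ends G ≗ Fin.remQuot m ∘ f × Forces H G))
    decide f with all? (λ e → proj₁ (Fin.remQuot {m} m (f e)) Fin.<? proj₂ (Fin.remQuot {m} m (f e)))
                | all? (λ e → all? λ e′ → (f e ≟ f e′) →-dec (e ≟ e′))
    ... | no ¬<  | _ = no λ (G , eq , _) → ¬< λ e →
          subst (λ p → proj₁ p Fin.< proj₂ p) (eq e) (Graph.ends-< G e)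
    ... | yes _  | no ¬inj = no λ (G , eq , _) → ¬inj λ e e′ fe≡fe′ → Graph.ends-injective G
          (trans (eq e) (trans (cong (Fin.remQuot m) fe≡fe′) (sym (eq e′))))
    ... | yes lt | yes inj = map′ (λ fr → G , (λ _ → refl) , fr)
          (λ (G′ , eq , fr) → forces-resp-ends G′ G eq fr) (Forces? H G)
      where
      G : Graph m t
      G = record
        { ends = Fin.remQuot m ∘ f
        ; ends-< = lt
        ; ends-injective = λ {e} {e′} eq → inj e e′ (trans (sym (Fin.combine-remQuot {m} m (f e)))
            (trans (cong (uncurry Fin.combine) eq) (Fin.combine-remQuot {m} m (f e′))))
        }

  delete-isolated : ∀ {m t} (G : Graph (suc m) t) v → (∀ e → ¬ Incident G v e) →
                    Forces H G → Σ[ G′ ∈ Graph m t ] Forces H G′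
  delete-isolated {m} {t} G v iso fr = G′ , forces-transport H G G′ (punchIn v)
    (λ {x} {y} → Fin.punchIn-injective v x y) to from noIso fr
    where
    v≢lo : ∀ e → v ≢ lo G e
    v≢lo e = iso e ∘ inj₁

    v≢hi : ∀ e → v ≢ hi G e
    v≢hi e = iso e ∘ inj₂

    G′ : Graph m t
    G′ = record
      { ends = λ e → punchOut (v≢lo e) , punchOut (v≢hi e)
      ; ends-< = λ e → Fin.≤∧≢⇒<
          (Fin.punchOut-mono-≤ (v≢lo e) (v≢hi e) (<⇒≤ (Graph.ends-< G e)))
          (λ eq → lo≢hi G e (punchOut-injective (v≢lo e) (v≢hi e) eq))
      ; ends-injective = λ {e} {f} eq → Graph.ends-injective G (cong₂ _,_
          (punchOut-injective (v≢lo e) (v≢lo f) (cong proj₁ eq))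
          (punchOut-injective (v≢hi e) (v≢hi f) (cong proj₂ eq)))
      }

    to : ∀ {x e} → Incident G′ x e → Incident G (punchIn v x) e
    to (inj₁ refl) = inj₁ (Fin.punchIn-punchOut _)
    to (inj₂ refl) = inj₂ (Fin.punchIn-punchOut _)

    from : ∀ {x e} → Incident G x e → ∃[ x′ ] (punchIn v x′ ≡ x × Incident G′ x′ e)
    from (inj₁ refl) = _ , Fin.punchIn-punchOut _ , inj₁ refl
    from (inj₂ refl) = _ , Fin.punchIn-punchOut _ , inj₂ refl

  -- A vertex is determined by an edge through it and its side of that edge.
  covered⇒order-≤ : ∀ {m t} (G : Graph m t) → NoIsolatedVertices G → m ≤ 2 * t
  covered⇒order-≤ {m} {t} G cov = card-≤ ↔-refl *↔× locate locate-injective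
    where
    locate : Fin m → Fin 2 × Fin t
    locate v with cov v
    ... | e , inj₁ _ = zero , e
    ... | e , inj₂ _ = suc zero , e

    locate-injective : Injective _≡_ _≡_ locate
    locate-injective {v} {w} eq with cov v | cov w
    ... | e , inj₁ p | f , inj₁ q with refl ← cong proj₂ eq = trans p (sym q)
    ... | e , inj₂ p | f , inj₂ q with refl ← cong proj₂ eq = trans p (sym q)
    ... | e , inj₁ p | f , inj₂ q with () ← cong proj₁ eq
    ... | e , inj₂ p | f , inj₁ q with () ← cong proj₁ eq

  -- Deleting isolated vertices one by one leaves at most `2 * t` vertices, so the search for
  -- Builder's graph is finite.
  shrink : ∀ m {t} (G : Graph m t) → Forces H G →
           ∃[ m′ ] (m′ < suc (2 * t) × Σ[ G′ ∈ Graph m′ t ] Forces H G′)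
  shrink m G fr with any? (λ v → all? λ e → ¬? (Incident? G v e))
  shrink (suc m) G fr | yes (v , iso) with delete-isolated G v iso fr
  ... | G′ , fr′ = shrink m G′ fr′
  shrink m G fr | no ¬iso = m , s≤s (covered⇒order-≤ G covered) , G , fr
    where
    covered : NoIsolatedVertices G
    covered v with any? (λ e → Incident? G v e)
    ... | yes found = found
    ... | no  none  = contradiction (v , λ e v∈e → none (e , v∈e)) ¬iso

  CanForce? : Decidable (CanForce H)
  CanForce? t = map′ (λ (m , _ , G , fr) → m , G , fr) (λ (m , G , fr) → shrink m G fr)
    (anyUpTo? (λ m → forces-on? m t) (suc (2 * t)))

-- Grundy colorings, which are First-Fit colorings freed from the order.

record Grundy {m t} (G : Graph m t) (c : Fin t → ℕ) : Set where
  field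
    positive : ∀ e → 1 ≤ c e
    proper   : Proper G c
    sees     : ∀ e {i} → 1 ≤ i → i < c e → ∃[ f ] (Adjacent G f e × c f ≡ i)

-- First-Fit reproduces a Grundy coloring when the edges come by increasing color.
grundy⇒canForce : ∀ {n k m t} {H : Graph n k} {G : Graph m t} {c} →
                  Grundy G c → RainbowCopy H G c → CanForce H t
grundy⇒canForce {m = m} {t = t} {H = H} {G = G} {c = c} grundy copy =
  m , G′ , c ∘ from , ff , record
    { vertex = vertex
    ; edge = to ∘ edge
    ; vertex-injective = vertex-injective
    ; incident = λ v e v∈e → subst (Incident G (vertex v)) (sym (from-to (edge e))) (incident v e v∈e)
    ; rainbow = λ {e} {f} eq → rainbow (subst₂ _≡_ (cong c (from-to (edge e))) (cong c (from-to (edge f))) eq)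
    }
  where
  open Grundy grundy
  open RainbowCopy copy

  π : Fin t ↔ Fin t
  π = proj₁ (sort c)

  open Inverse π using (to; from)

  from-to : ∀ e → from (to e) ≡ e
  from-to = Inverse.strictlyInverseʳ π

  to-from : ∀ e → to (from e) ≡ e
  to-from = Inverse.strictlyInverseˡ π

  from-injective : Injective _≡_ _≡_ from
  from-injective = to-injective (↔-sym π)

  G′ : Graph m t
  G′ = record
    { ends = Graph.ends G ∘ from
    ; ends-< = Graph.ends-< G ∘ from
    ; ends-injective = from-injective ∘ Graph.ends-injective G
    }

  ff : IsFirstFit G′ (c ∘ from)
  ff e = (positive (from e) , λ f _ (f≢e , share) → proper (from f) (from e) (f≢e ∘ from-injective , share)) ,
         λ j (1≤j , free) → ≮⇒≥ λ j<ce → conflict (1≤j , free) (sees (from e) 1≤j j<ce) j<ce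
    where
    conflict : ∀ {j} → 1 ≤ j × (∀ f → f Fin.< e → Adjacent G′ f e → c (from f) ≢ j) →
               ∃[ f ] (Adjacent G f (from e) × c f ≡ j) → ¬ (j < c (from e))
    -- Sorting puts smaller colors first, so the edge of color `j` is presented before `e` and
    -- blocks `j`.
    conflict (_ , free) (f , (f≢ , v , v∈f , v∈e) , refl) lt = free (to f)
      (subst (to f Fin.<_) (to-from e) (proj₂ (sort c) lt))
      ( (λ { refl → f≢ (sym (from-to f)) })
      , v , subst (Incident G v) (sym (from-to f)) v∈f , v∈e)
      (cong c (from-to f))

-- Builder's graph, assembled from slots.

-- The slots at a vertex v are places for edges that Builder presents at v; their
-- levels are 1, …, d for some d depending on v.
record Slots {n k} (H : Graph n k) (c : Fin k → ℕ) (t : ℕ) : Set where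
  field
    at        : Fin t → Fin n
    level     : Fin t → ℕ
    1≤level   : ∀ s → 1 ≤ level s
    unique    : ∀ {s s′} → at s ≡ at s′ → level s ≡ level s′ → s ≡ s′
    lower     : ∀ s {i} → 1 ≤ i → i < level s → ∃[ s′ ] (at s′ ≡ at s × level s′ ≡ i)
    home      : Fin k → Fin t
    home-at   : ∀ f → Incident H (at (home f)) f
    level-home : ∀ f → level (home f) ≡ c f

-- Each slot is filled by the edge of H of its color, if that edge lives there, and by
-- a pendant edge, if no edge of H of its color meets its vertex.  A slot whose color
-- is provided by an edge of H living in another slot is filled by an isolated edge,
-- so that the number of edges is exactly the number of slots.
module _ {n k t} {H : Graph n k} {c : Fin k → ℕ} (rb : RainbowColoring H c)
         (slots : Slots H c t) where
  open Slots slots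

  data Filling (s : Fin t) : Set where
    hosted  : ∀ f → home f ≡ s → Filling s
    pendant : (∀ f → Incident H (at s) f → c f ≢ level s) → Filling s
    dummy   : (∀ f → home f ≢ s) → ∀ f → Incident H (at s) f → c f ≡ level s → Filling s

  filling : ∀ s → Filling s
  filling s with any? (λ f → home f ≟ s)
  ... | yes (f , home-f) = hosted f home-f
  ... | no  ¬home with any? (λ f → Incident? H (at s) f ×-dec (c f ℕ.≟ level s))
  ...   | yes (f , f∋ , cf≡) = dummy (λ f h → ¬home (f , h)) f f∋ cf≡
  ...   | no  none = pendant λ f f∋ cf≡ → none (f , f∋ , cf≡)

  -- The vertices of `H` and two private vertices for each slot: a pendant edge uses one of these,
  -- an isolated edge both.
  Vertex : Set
  Vertex = Fin n ⊎ (Fin t ⊎ Fin t)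

  loᶠ hiᶠ : ∀ {s} → Filling s → Vertex
  loᶠ     (hosted f _)    = inj₁ (lo H f)
  loᶠ {s} (pendant _)     = inj₁ (at s)
  loᶠ {s} (dummy _ _ _ _) = inj₂ (inj₁ s)
  hiᶠ     (hosted f _)    = inj₁ (hi H f)
  hiᶠ {s} (pendant _)     = inj₂ (inj₁ s)
  hiᶠ {s} (dummy _ _ _ _) = inj₂ (inj₂ s)

  colorᶠ : ∀ {s} → Filling s → ℕ
  colorᶠ {s} (hosted _ _)    = level s
  colorᶠ {s} (pendant _)     = level s
  -- First-Fit gives color 1 to an isolated edge, whatever the level of its slot.
  colorᶠ     (dummy _ _ _ _) = 1

  _∈ᶠ_ : Vertex → ∀ {s} → Filling s → Set
  v ∈ᶠ F = v ≡ loᶠ F ⊎ v ≡ hiᶠ F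

  owner : Fin t ⊎ Fin t → Fin t
  owner (inj₁ s) = s
  owner (inj₂ s) = s

  owner-∈ᶠ : ∀ {l s} (F : Filling s) → inj₂ l ∈ᶠ F → owner l ≡ s
  owner-∈ᶠ (pendant _)     (inj₂ refl) = refl
  owner-∈ᶠ (dummy _ _ _ _) (inj₁ refl) = refl
  owner-∈ᶠ (dummy _ _ _ _) (inj₂ refl) = refl
  owner-∈ᶠ (hosted _ _)    (inj₁ ())
  owner-∈ᶠ (hosted _ _)    (inj₂ ())

  NotInH : Fin t → Set
  NotInH s = ∀ f → Incident H (at s) f → c f ≢ level s

  old-∈ᶠ : ∀ {x s} (F : Filling s) → inj₁ x ∈ᶠ F → colorᶠ F ≡ level s ×
           ((∃[ f ] (home f ≡ s × Incident H x f)) ⊎ (x ≡ at s × NotInH s))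
  old-∈ᶠ (hosted f h)    (inj₁ refl) = refl , inj₁ (f , h , inj₁ refl)
  old-∈ᶠ (hosted f h)    (inj₂ refl) = refl , inj₁ (f , h , inj₂ refl)
  old-∈ᶠ (pendant no-f)  (inj₁ refl) = refl , inj₂ (refl , no-f)
  old-∈ᶠ (dummy _ _ _ _) (inj₁ ())
  old-∈ᶠ (dummy _ _ _ _) (inj₂ ())

  -- A private vertex lies only on the edge of its owner. At a vertex of `H`, equal colors identify
  -- two hosted edges because `c` is rainbow and two pendant edges by `unique`; a pendant edge
  -- avoids the colors of `H` there.
  proper-at : ∀ {v s s′} (F : Filling s) (F′ : Filling s′) → v ∈ᶠ F → v ∈ᶠ F′ →
              colorᶠ F ≡ colorᶠ F′ → s ≡ s′
  proper-at {inj₂ l} F F′ v∈ v∈′ _ = trans (sym (owner-∈ᶠ F v∈)) (owner-∈ᶠ F′ v∈′)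
  proper-at {inj₁ x} F F′ v∈ v∈′ eq with old-∈ᶠ F v∈ | old-∈ᶠ F′ v∈′
  ... | c≡ , inj₁ (f , refl , _) | c′≡ , inj₁ (g , refl , _) = cong home (proj₂ rb
        (trans (sym (level-home f)) (trans (trans (sym c≡) (trans eq c′≡)) (level-home g))))
  ... | c≡ , inj₁ (f , refl , x∈f) | c′≡ , inj₂ (refl , no-f) =
        contradiction (trans (sym (level-home f)) (trans (sym c≡) (trans eq c′≡))) (no-f f x∈f)
  ... | c≡ , inj₂ (refl , no-f) | c′≡ , inj₁ (f , refl , x∈f) =
        contradiction (trans (sym (level-home f)) (trans (sym c′≡) (trans (sym eq) c≡))) (no-f f x∈f)
  ... | c≡ , inj₂ (refl , _) | c′≡ , inj₂ (at≡ , _) =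
        unique at≡ (trans (sym c≡) (trans eq c′≡))

  ends-unique : ∀ {s s′} (F : Filling s) (F′ : Filling s′) →
                loᶠ F ≡ loᶠ F′ → hiᶠ F ≡ hiᶠ F′ → s ≡ s′
  ends-unique (hosted f refl) (hosted g refl) lo≡ hi≡ =
    cong home (Graph.ends-injective H (cong₂ _,_ (inj₁-injective lo≡) (inj₁-injective hi≡)))
  ends-unique (pendant _)     F′ _ hi≡ = owner-∈ᶠ F′ (inj₂ hi≡)
  ends-unique (dummy _ _ _ _) F′ _ hi≡ = owner-∈ᶠ F′ (inj₂ hi≡)
  ends-unique (hosted _ _) (pendant _)     _ ()
  ends-unique (hosted _ _) (dummy _ _ _ _) _ ()

  -- The edge `f` rules out the other two fillings of its home, and the rainbow condition identifies
  -- the host with `f`.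
  hosted-home : ∀ f (F : Filling (home f)) → colorᶠ F ≡ c f ×
                (∀ {x} → Incident H x f → inj₁ x ∈ᶠ F)
  hosted-home f (pendant no-f) = contradiction (sym (level-home f)) (no-f f (home-at f))
  hosted-home f (dummy no-home _ _ _) = contradiction refl (no-home f)
  hosted-home f (hosted g h)
    with refl ← proj₂ rb (trans (sym (level-home g)) (trans (cong level h) (level-home f))) =
    level-home f , λ { (inj₁ refl) → inj₁ refl ; (inj₂ refl) → inj₂ refl }

  -- A dummy has color 1 and no smaller color to see. The other fillings contain `at s`, the vertex
  -- where smaller colors are provided.
  at-∈ᶠ : ∀ {s} (F : Filling s) {i} → 1 ≤ i → i < colorᶠ F → inj₁ (at s) ∈ᶠ F × i < level s
  at-∈ᶠ (hosted f refl) _ i< with home-at f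
  ... | inj₁ eq = inj₁ (cong inj₁ eq) , i<
  ... | inj₂ eq = inj₂ (cong inj₁ eq) , i<
  at-∈ᶠ (pendant _) _ i< = inj₁ refl , i<
  at-∈ᶠ (dummy _ _ _ _) 1≤i i<1 = contradiction 1≤i (<⇒≱ i<1)

  no-H-edge⇒pendant : ∀ {s} (F : Filling s) → NotInH s → inj₁ (at s) ∈ᶠ F × colorᶠ F ≡ level s
  no-H-edge⇒pendant (hosted f refl) no-f = contradiction (sym (level-home f)) (no-f f (home-at f))
  no-H-edge⇒pendant (pendant _) _ = inj₁ refl , refl
  no-H-edge⇒pendant (dummy _ f f∋ cf≡) no-f = contradiction cf≡ (no-f f f∋)

  -- Either an edge of `H` at this vertex has color `i`, possibly living in a slot elsewhere, or the
  -- slot of level `i` here holds a pendant edge.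
  present-at : ∀ s {i} → 1 ≤ i → i < level s →
               ∃[ s′ ] (inj₁ (at s) ∈ᶠ filling s′ × colorᶠ (filling s′) ≡ i)
  present-at s {i} 1≤i i< with any? (λ f → Incident? H (at s) f ×-dec (c f ℕ.≟ i))
  ... | yes (f , f∋ , cf≡i) = let (col , inc) = hosted-home f (filling (home f))
                              in home f , inc f∋ , trans col cf≡i
  ... | no none with lower s 1≤i i<
  ...   | s′ , at≡ , refl
    with no-H-edge⇒pendant (filling s′) (λ f f∋ cf≡ →
           none (f , subst (λ v → Incident H v f) at≡ f∋ , cf≡))
  ...     | v∈ , col = s′ , subst (λ v → inj₁ v ∈ᶠ filling s′) at≡ v∈ , col

  -- Vertices of `H` come first, then the two blocks of private vertices, so that the ends of every
  -- filling are in increasing order.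
  code : Vertex → Fin (n + (t + t))
  code = Fin.join n (t + t) ∘ map₂⊎ (Fin.join t t)

  code-injective : Injective _≡_ _≡_ code
  code-injective = to-injective (↔-sym (↔-trans +↔⊎ (↔-refl ⊎-↔ +↔⊎)))

  code-< : ∀ {s} (F : Filling s) → code (loᶠ F) Fin.< code (hiᶠ F)
  code-< (hosted f _) = subst₂ _<_
    (sym (Fin.toℕ-↑ˡ (lo H f) (t + t))) (sym (Fin.toℕ-↑ˡ (hi H f) (t + t))) (Graph.ends-< H f)
  code-< {s} (pendant _) = subst₂ _<_
    (sym (Fin.toℕ-↑ˡ (at s) (t + t))) (sym (Fin.toℕ-↑ʳ n (s Fin.↑ˡ t)))
    (≤-trans (toℕ<n (at s)) (m≤m+n n _))
  code-< {s} (dummy _ _ _ _) = subst₂ _<_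
    (sym (Fin.toℕ-↑ʳ n (s Fin.↑ˡ t))) (sym (Fin.toℕ-↑ʳ n (t Fin.↑ʳ s)))
    (+-monoʳ-< n (subst₂ _<_ (sym (Fin.toℕ-↑ˡ s t)) (sym (Fin.toℕ-↑ʳ t s))
      (≤-trans (toℕ<n s) (m≤m+n t _))))

  slotGraph : Graph (n + (t + t)) t
  slotGraph = record
    { ends = λ s → code (loᶠ (filling s)) , code (hiᶠ (filling s))
    ; ends-< = λ s → code-< (filling s)
    ; ends-injective = λ {s} {s′} eq → ends-unique (filling s) (filling s′)
        (code-injective (cong proj₁ eq)) (code-injective (cong proj₂ eq))
    }

  ∈ᶠ⇒Incident : ∀ {v s} → v ∈ᶠ filling s → Incident slotGraph (code v) s
  ∈ᶠ⇒Incident (inj₁ eq) = inj₁ (cong code eq)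
  ∈ᶠ⇒Incident (inj₂ eq) = inj₂ (cong code eq)

  Incident⇒∈ᶠ : ∀ {w s} → Incident slotGraph w s → ∃[ v ] (code v ≡ w × v ∈ᶠ filling s)
  Incident⇒∈ᶠ (inj₁ refl) = _ , refl , inj₁ refl
  Incident⇒∈ᶠ (inj₂ refl) = _ , refl , inj₂ refl

  color : Fin t → ℕ
  color s = colorᶠ (filling s)

  slotGraph-grundy : Grundy slotGraph color
  slotGraph-grundy = record { positive = positive ; proper = proper ; sees = sees }
    where
    positive : ∀ s → 1 ≤ color s
    positive s with filling s
    ... | hosted _ _    = 1≤level s
    ... | pendant _     = 1≤level s
    ... | dummy _ _ _ _ = ≤-refl

    proper : Proper slotGraph color
    proper s s′ (s≢s′ , w , w∈s , w∈s′) eq with Incident⇒∈ᶠ {s = s} w∈s | Incident⇒∈ᶠ {s = s′} w∈s′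
    ... | v , refl , v∈ | v′ , code≡ , v′∈ with refl ← code-injective {v′} {v} code≡ =
      s≢s′ (proper-at (filling s) (filling s′) v∈ v′∈ eq)

    sees : ∀ s {i} → 1 ≤ i → i < color s → ∃[ s′ ] (Adjacent slotGraph s′ s × color s′ ≡ i)
    sees s 1≤i i< with at-∈ᶠ (filling s) 1≤i i<
    ... | at∈ , i<level with present-at s 1≤i i<level
    ...   | s′ , at∈′ , col = s′ ,
      ((λ { refl → <-irrefl (sym col) i< }) , _ , ∈ᶠ⇒Incident {s = s′} at∈′ , ∈ᶠ⇒Incident {s = s} at∈) , col

  slots⇒canForce : CanForce H t
  slots⇒canForce = grundy⇒canForce slotGraph-grundy record
    { vertex = code ∘ inj₁
    ; edge = home
    ; vertex-injective = inj₁-injective ∘ code-injective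
    ; incident = λ v f v∈f → ∈ᶠ⇒Incident {s = home f} (proj₂ (hosted-home f (filling (home f))) v∈f)
    ; rainbow = λ {e} {f} eq → proj₂ rb
        (trans (sym (proj₁ (hosted-home e (filling (home e)))))
          (trans eq (proj₁ (hosted-home f (filling (home f))))))
    }

-- Slots at both ends of a dominating matching.

module _ {n k} (H : Graph n k) {c M} (rb : RainbowColoring H c) (isM : IsMatching H M)
         (dom : ∀ f → Dominated H c M f) where
  private
    units↔ : Fin (2 * weight H c M) ↔ (Fin 2 × Units (restrict M c))
    units↔ = ↔-trans *↔× (↔-refl ×-↔ units _)

    end : Fin 2 → Fin k → Fin n
    end zero       = lo H
    end (suc zero) = hi H

    end-incident : ∀ x e → Incident H (end x e) e
    end-incident zero       e = inj₁ refl
    end-incident (suc zero) e = inj₂ refl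

    incident-end : ∀ {v e} → Incident H v e → ∃[ x ] end x e ≡ v
    incident-end (inj₁ refl) = zero , refl
    incident-end (inj₂ refl) = suc zero , refl

    end-injective : ∀ {x y} e → end x e ≡ end y e → x ≡ y
    end-injective {zero}     {zero}     e _  = refl
    end-injective {suc zero} {suc zero} e _  = refl
    end-injective {zero}     {suc zero} e eq = contradiction eq (lo≢hi H e)
    end-injective {suc zero} {zero}     e eq = contradiction (sym eq) (lo≢hi H e)

    atᵘ : Fin 2 × Units (restrict M c) → Fin n
    atᵘ (x , e , _) = end x e

    levelᵘ : Fin 2 × Units (restrict M c) → ℕ
    levelᵘ (_ , _ , i) = suc (toℕ i)

    -- A vertex lies on at most one edge of the matching, so the slots at it come from a single edge
    -- and a single side.
    uniqueᵘ : ∀ {p q} → atᵘ p ≡ atᵘ q → levelᵘ p ≡ levelᵘ q → p ≡ q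
    uniqueᵘ {x , e , i} {y , f , j} at≡ level≡
      with matching-unique H isM (restrict-∈ M c e i) (restrict-∈ M c f j) (end-incident x e)
             (subst (λ v → Incident H v f) (sym at≡) (end-incident y f))
    ... | refl = cong₂ _,_ (end-injective e at≡) (Units-≡ refl (suc-injective level≡))

    fillᵘ : ∀ x {e i} → e ∈ M → 1 ≤ i → i ≤ c e → ∃[ p ] (atᵘ p ≡ end x e × levelᵘ p ≡ i)
    fillᵘ x {e} {suc i} e∈M _ i<ce = let (j , j≡i) = restrict-fill M c e∈M i<ce
                                     in (x , e , j) , refl , cong suc j≡i

    lowerᵘ : ∀ p {i} → 1 ≤ i → i < levelᵘ p → ∃[ q ] (atᵘ q ≡ atᵘ p × levelᵘ q ≡ i)
    lowerᵘ (x , e , j) 1≤i i≤j = fillᵘ x (restrict-∈ M c e j) 1≤i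
      (<⇒≤ (<-≤-trans i≤j (restrict-< M c e j)))

    -- Domination yields an edge of `M` that meets `f` and whose levels reach at least `c f`.
    homeᵘ : ∀ f → ∃[ p ] (Incident H (atᵘ p) f × levelᵘ p ≡ c f)
    homeᵘ f = let (e , e∈M , cf≤ce , v , v∈e , v∈f) = dom f
                  (x , x≡v) = incident-end v∈e
                  (p , at≡ , level≡) = fillᵘ x e∈M (proj₁ rb f) cf≤ce
              in p , subst (λ v → Incident H v f) (sym (trans at≡ x≡v)) v∈f , level≡

    open Inverse units↔ using (to; from)

    to-from : ∀ p → to (from p) ≡ p
    to-from = Inverse.strictlyInverseˡ units↔

    slots : Slots H c (2 * weight H c M)
    slots = record
      { at = atᵘ ∘ to
      ; level = levelᵘ ∘ to
      ; 1≤level = λ _ → s≤s z≤n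
      ; unique = λ at≡ level≡ → to-injective units↔ (uniqueᵘ at≡ level≡)
      ; lower = λ s 1≤i i< → let (p , at≡ , level≡) = lowerᵘ (to s) 1≤i i< in
          from p , trans (cong atᵘ (to-from p)) at≡ , trans (cong levelᵘ (to-from p)) level≡
      ; home = from ∘ proj₁ ∘ homeᵘ
      ; home-at = λ f → subst (λ p → Incident H (atᵘ p) f) (sym (to-from (proj₁ (homeᵘ f)))) (proj₁ (proj₂ (homeᵘ f)))
      ; level-home = λ f → trans (cong levelᵘ (to-from (proj₁ (homeᵘ f)))) (proj₂ (proj₂ (homeᵘ f)))
      }

  dominating⇒canForce : CanForce H (2 * weight H c M)
  dominating⇒canForce = slots⇒canForce rb slots

-- Total weight of a rainbow coloring and of its color classes.

-- A pair of edges is charged to the edge of larger color, in the position given by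
-- the smaller color, and the first factor records which of the two is which.
square-≤-Σℕ : ∀ {k} {c : Fin k → ℕ} → (∀ e → 1 ≤ c e) → Injective _≡_ _≡_ c → k * k ≤ 2 * Σℕ c
square-≤-Σℕ {k} {c} 1≤c c-inj =
  card-≤ *↔× (↔-trans *↔× (↔-refl ×-↔ units c)) charge charge-injective
  where
  slot : ∀ e f → c f ≤ c e → ∃[ i ] suc (toℕ {c e} i) ≡ c f
  slot e f cf≤ce with c f | 1≤c f
  ... | suc x | _ = fromℕ< cf≤ce , cong suc (toℕ-fromℕ< cf≤ce)

  charge : Fin k × Fin k → Fin 2 × Units c
  charge (e , f) with c f ≤? c e
  ... | yes f≤e = zero , e , proj₁ (slot e f f≤e)
  ... | no  f≰e = suc zero , f , proj₁ (slot f e (<⇒≤ (≰⇒> f≰e)))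

  -- The position gives the smaller color, which determines its edge since `c` is injective.
  slot-injective : ∀ {e e′ f f′ p q} →
    (e , proj₁ (slot e f p)) ≡ (Units c ∋ (e′ , proj₁ (slot e′ f′ q))) → e ≡ e′ × f ≡ f′
  slot-injective {e} {e′} {f} {f′} {p} {q} eq = cong proj₁ eq , c-inj
    (trans (sym (proj₂ (slot e f p)))
      (trans (cong (λ x → suc (toℕ (proj₂ x))) eq) (proj₂ (slot e′ f′ q))))

  charge-injective : Injective _≡_ _≡_ charge
  charge-injective {e , f} {e′ , f′} eq with c f ≤? c e | c f′ ≤? c e′
  ... | yes p | yes q = let (a , b) = slot-injective (cong proj₂ eq) in cong₂ _,_ a b
  ... | no p  | no q  = let (a , b) = slot-injective (cong proj₂ eq) in cong₂ _,_ b a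
  ... | yes _ | no _  with () ← cong proj₁ eq
  ... | no _  | yes _ with () ← cong proj₁ eq

-- The color classes of a proper coloring are matchings covering every edge.
Σℕ-≤-maximum : ∀ {n k q} (H : Graph n k) {c M} {col : Fin k → Fin q} →
               Proper H col → IsMaximumMatching H c M → Σℕ c ≤ q * weight H c M
Σℕ-≤-maximum {q = q} H {c} {M} {col} proper (_ , M-max) = begin
  Σℕ c
    ≤⟨ Σℕ-mono-≤ (λ e → ≤-trans (in-class e) (term≤Σℕ (λ x → restrict (class x) c e) (col e))) ⟩
  Σℕ (λ e → Σℕ λ x → restrict (class x) c e)
    ≡⟨ ∑-comm +-0-commutativeMonoid (λ e x → restrict (class x) c e) ⟩
  Σℕ (λ x → weight H c (class x))
    ≤⟨ Σℕ-≤-* (λ x → M-max (class x) (class-matching x)) ⟩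
  q * weight H c M ∎
  where
  open ≤-Reasoning

  class : Fin q → Subset _
  class x = select λ e → col e ≟ x

  class-matching : ∀ x → IsMatching H (class x)
  class-matching x e f e∈ f∈ adj = proper e f adj
    (trans (select⁻ (λ e → col e ≟ x) e∈) (sym (select⁻ (λ e → col e ≟ x) f∈)))

  in-class : ∀ e → c e ≤ restrict (class (col e)) c e
  in-class e rewrite []=⇒lookup (select⁺ (λ f → col f ≟ col e) {e} refl) = ≤-refl

-- Light greedy matchings from a vertex cover.

module _ {n k} (H : Graph n k) {S : Subset n} (cover : IsVertexCover H S) where

  -- The star containing `e`, numbered by the position of its center within the cover.
  block : Fin k → Fin ∣ S ∣
  block e = let (v , v∈S , _) = cover e in
    Inverse.from (members S) (v , proj₁ (restrict-fill S _ v∈S (s≤s z≤n)))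

  block-unique : ∀ {M} → IsMatching H M → ∀ {e f} → e ∈ M → f ∈ M → block e ≡ block f → e ≡ f
  block-unique isM {e} {f} e∈M f∈M eq = matching-unique H isM e∈M f∈M (proj₂ (proj₂ (cover e)))
    (subst (λ v → Incident H v f) (sym same) (proj₂ (proj₂ (cover f))))
    where
    same : proj₁ (cover e) ≡ proj₁ (cover f)
    same = cong proj₁ (to-injective (↔-sym (members S)) eq)

  module _ (β : Fin k → ℕ) (M : Subset k) where
    open Rank β

    -- As `rank e` is the size of `below e`, the units of weight at `e` correspond to the edges
    -- ranked no later than `e`.
    charge : Units (restrict M rank) → Fin k × Fin k
    charge (e , i) = e , proj₁ (Inverse.to (members (below e)) (fromℕ< (restrict-< M rank e i)))

    charge-∈ : ∀ x → proj₁ (charge x) ∈ M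
    charge-∈ (e , i) = restrict-∈ M rank e i

    charge-≤ : ∀ x → β (proj₂ (charge x)) ≤ β (proj₁ (charge x))
    charge-≤ (e , i) = let (f , j) = Inverse.to (members (below e)) (fromℕ< (restrict-< M rank e i))
                       in below⇒β≤ (restrict-∈ (below e) _ f j)

    charge-injective : ∀ x y → charge x ≡ charge y → x ≡ y
    charge-injective (e , i) (e′ , i′) eq with cong proj₁ eq
    ... | refl = Units-≡ refl
      (fromℕ<-injective _ _ (restrict-< M rank e i) (restrict-< M rank e i′)
        (to-injective (members (below e)) (member-≡ (below e) (cong proj₂ eq))))

  β↑ β↓ : Fin k → ℕ
  β↑ e = toℕ (block e)
  β↓ e = ∣ S ∣ ∸ toℕ (block e)

  -- A greedy matching has at most one edge in each block, whose color is at most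
  -- the number of edges in the blocks up to its own.  Over an ordering of the blocks
  -- and the reversed one, an edge f is counted at most once for every block, and
  -- once more for its own.
  two-orders : ∀ {M M′} → IsMatching H M → IsMatching H M′ →
    weight H (Rank.rank β↑) M + weight H (Rank.rank β↓) M′ ≤ suc ∣ S ∣ * k
  two-orders {M} {M′} isM isM′ =
    card-≤ (↔-trans +↔⊎ (units _ ⊎-↔ units _)) *↔× assign assign-injective
    where
    assign : Units (restrict M (Rank.rank β↑)) ⊎ Units (restrict M′ (Rank.rank β↓)) →
             Fin (suc ∣ S ∣) × Fin k
    -- If `f` lies in block `p`, this order gives it labels above `p` and the reversed order labels
    -- up to `p`. The shift by one separates the two and accounts for the factor `suc ∣ S ∣`.
    assign (inj₁ x) = let (e , f) = charge β↑ M x  in suc (block e) , f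
    assign (inj₂ x) = let (e , f) = charge β↓ M′ x in Fin.inject₁ (block e) , f

    distinct : ∀ x y → assign (inj₁ x) ≢ assign (inj₂ y)
    distinct x y eq = <-irrefl refl (begin-strict
      toℕ (block e)  <⟨ ≤-reflexive (trans (cong (toℕ ∘ proj₁) eq) (Fin.toℕ-inject₁ (block e′))) ⟩
      toℕ (block e′) ≤⟨ ≮⇒≥ (λ lt → <⇒≱ (∸-monoʳ-< lt (Fin.toℕ≤n (block e′))) (charge-≤ β↓ M′ y)) ⟩
      toℕ (block f′) ≡⟨ cong (toℕ ∘ block ∘ proj₂) eq ⟨
      toℕ (block f)  ≤⟨ charge-≤ β↑ M x ⟩
      toℕ (block e)  ∎)
      where
      open ≤-Reasoning
      e f e′ f′ : Fin k
      e  = proj₁ (charge β↑ M x)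
      f  = proj₂ (charge β↑ M x)
      e′ = proj₁ (charge β↓ M′ y)
      f′ = proj₂ (charge β↓ M′ y)

    assign-injective : Injective _≡_ _≡_ assign
    assign-injective {inj₁ x} {inj₁ y} eq = cong inj₁ (charge-injective β↑ M x y (cong₂ _,_
      (block-unique isM (charge-∈ β↑ M x) (charge-∈ β↑ M y) (Fin.suc-injective (cong proj₁ eq)))
      (cong proj₂ eq)))
    assign-injective {inj₂ x} {inj₂ y} eq = cong inj₂ (charge-injective β↓ M′ x y (cong₂ _,_
      (block-unique isM′ (charge-∈ β↓ M′ x) (charge-∈ β↓ M′ y) (Fin.inject₁-injective (cong proj₁ eq)))
      (cong proj₂ eq)))
    assign-injective {inj₁ x} {inj₂ y} eq = contradiction eq (distinct x y)
    assign-injective {inj₂ x} {inj₁ y} eq = contradiction (sym eq) (distinct y x)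

  -- The minimum `w` is at most the greedy weight for either order of the blocks, so `2 * w` is at
  -- most their sum.
  w-greedy-≤ : ∀ {w} → Is-w-greedy H w → 2 * w ≤ suc ∣ S ∣ * k
  w-greedy-≤ {w} (_ , w-min) with greedyMatching-exists H (Rank.rank β↑)
                                | greedyMatching-exists H (Rank.rank β↓)
  ... | M , greedy | M′ , greedy′ = begin
    2 * w
      ≡⟨ cong (λ x → w + x) (+-identityʳ w) ⟩
    w + w
      ≤⟨ +-mono-≤ (w≤ β↑ greedy) (w≤ β↓ greedy′) ⟩
    weight H (Rank.rank β↑) M + weight H (Rank.rank β↓) M′
      ≤⟨ two-orders (greedyRun⇒matching H (proj₁ greedy))
                    (greedyRun⇒matching H (proj₁ greedy′)) ⟩
    suc ∣ S ∣ * k ∎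
    where
    open ≤-Reasoning
    w≤ : ∀ β {M} → IsGreedyMatching H (Rank.rank β) M → w ≤ weight H (Rank.rank β) M
    w≤ β {M} greedy = w-min _ (Rank.rank β , (Rank.1≤rank β , Rank.rank-injective β) , M , greedy , refl)

-- Combination of the bounds.

-- Since `_/_` reduces fractions to lowest terms, the cross-multiplication takes place in the
-- unnormalised rationals.
frac-≤ : ∀ a b c d {{_ : NonZero b}} {{_ : NonZero d}} → a * d ≤ c * b → + a / b ℚ.≤ + c / d
frac-≤ a (suc b) c (suc d) ad≤cb = toℚᵘ-cancel-≤ (ℚᵘ.≤-trans
  (ℚᵘ.≤-reflexive (toℚᵘ-fromℚᵘ (mkℚᵘ (+ a) b)))
  (ℚᵘ.≤-trans (*≤* (subst₂ ℤ._≤_ (pos-* a (suc d)) (pos-* c (suc b)) (+≤+ ad≤cb)))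
    (ℚᵘ.≤-reflexive (ℚᵘ.≃-sym (toℚᵘ-fromℚᵘ (mkℚᵘ (+ c) d))))))

w-greedy-forced : ∀ {n k} (H : Graph n k) {w} → Is-w-greedy H w → CanForce H (2 * w)
w-greedy-forced H ((c , rb , M , greedy , refl) , _) =
  dominating⇒canForce H rb (greedyRun⇒matching H (proj₁ greedy)) (greedy-dominated H greedy)

-- The First-Fit colors on the copy form a rainbow coloring of `H`, whose maximum matching weighs at
-- least `w` and at most `2 * t`.
w-max-≤ : ∀ {n k} (H : Graph n k) {w t} → Is-w-max H w → CanForce H t → w ≤ 2 * t
w-max-≤ H (_ , w-min) (_ , G , c , ff , copy) with maximumMatching-exists H (c ∘ RainbowCopy.edge copy)
... | M , M-max = ≤-trans
  (w-min _ (c ∘ edge , ((λ e → proj₁ (proj₁ (ff (edge e)))) , rainbow) , M , M-max , refl))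
  (matching-weight-≤ ff copy (proj₁ M-max))
  where open RainbowCopy copy

square-≤-w-max : ∀ {n k q} (H : Graph n k) {w} {col : Fin k → Fin q} →
                 Proper H col → Is-w-max H w → k * k ≤ 2 * (q * w)
square-≤-w-max H proper ((c , rb , M , M-max , refl) , _) =
  ≤-trans (square-≤-Σℕ (proj₁ rb) (proj₂ rb)) (*-monoʳ-≤ 2 (Σℕ-≤-maximum H proper M-max))

lemma11 : ∀ {n k} (H : Graph n k) → NoIsolatedVertices H → (1≤k : 1 ≤ k) →
    ∀ {χ′ τ w-max w-greedy} →
    (isχ′ : IsChromaticIndex H χ′) → IsVertexCoverNumber H τ →
    Is-w-max H w-max → Is-w-greedy H w-greedy →
    ∃[ ar ] (IsAR-FF H ar ×
    _/_ (+ (k * k)) (4 * χ′) {{4χ′≢0 H 1≤k isχ′}} ℚ.≤ + w-max / 2 ×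
    + w-max / 2 ℚ.≤ + ar / 1 ×
    ar ≤ 2 * w-greedy ×
    2 * w-greedy ≤ (τ + 1) * k)
lemma11 {k = k} H noIso 1≤k {χ′} {τ} {w-max} {w-greedy}
        isχ′@((_ , proper) , _) ((S , cover , ∣S∣≡τ) , _) ismax isgreedy =
  -- Builder's strategy with `2 * w-greedy` edges bounds the search for `ar`.
  let ar , isAR@(forced , ar-min) = least (CanForce? H noIso) (w-greedy-forced H isgreedy) in
  ar , isAR ,
  frac-≤ (k * k) (4 * χ′) w-max 2 {{4χ′≢0 H 1≤k isχ′}}
    (≤-trans (*-monoˡ-≤ 2 (square-≤-w-max H proper ismax)) (≤-reflexive (rearrange χ′ w-max))) ,
  frac-≤ w-max 2 ar 1 (begin
    w-max * 1  ≡⟨ *-identityʳ w-max ⟩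
    w-max      ≤⟨ w-max-≤ H ismax forced ⟩
    2 * ar     ≡⟨ *-comm 2 ar ⟩
    ar * 2     ∎) ,
  ar-min _ (w-greedy-forced H isgreedy) ,
  ≤-trans (w-greedy-≤ H cover isgreedy)
    (≤-reflexive (cong (_* k) (trans (cong suc ∣S∣≡τ) (+-comm 1 τ))))
  where
  open ≤-Reasoning

  rearrange : ∀ x w → 2 * (x * w) * 2 ≡ w * (4 * x)
  rearrange = solve-∀
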